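{- For every ordered graph $F$, $\rho_{<}(F) = 0$ if and only if $F$ does not contain a monotone path of length two, i.e. there are no vertices $u<v<w$ of $F$ with $uv$ and $vw$ both edges of $F$.
   Context: An ordered graph is a graph whose vertex set carries a total order. An ordered graph $G$ contains an ordered graph $F$ if there is an injective order-preserving map $V(F)\to V(G)$ sending edges of $F$ to edges of $G$; otherwise $G$ is $F$-free. For ordered graphs $F,G$ (with $e(G)>0$), $\rho_{<}(F,G)=\max\{e(G')/e(G): G'\subseteq G,\ G'\ F\text{ -free}\}$, and the relative Turán density is $\rho_{<}(F)=\inf_G\rho_{<}(F,G)$ over all ordered graphs $G$. -}

module Defs where

open import Data.Bool using (Bool; T)
open import Data.Bool.Properties using (T?)
open import Data.Fin using (Fin; _<_; _≤_; _<?_)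
open import Data.Fin.Subset using (Subset; _∈_)
open import Data.Integer using (+_)
open import Data.List using (length; filter; allFin; cartesianProduct)
open import Data.Nat using (ℕ; NonZero)
open import Data.Product using (_×_; _,_; ∃; ∃-syntax)
open import Data.Rational as ℚ using (ℚ; 0ℚ; _/_)
open import Data.Sum using (_⊎_)
open import Function.Definitions using (Injective)
open import Relation.Binary.Core using (_Preserves_⟶_)
open import Relation.Binary.PropositionalEquality using (_≡_)
open import Relation.Nullary using (¬_; _×-dec_)

-- A finite totally ordered vertex set is uniquely isomorphic to some Fin n
-- with its usual order, so Fin n is taken as the vertex set.
record OrderedGraph : Set where
  field
    order  : ℕ
    adj    : Fin order → Fin order → Bool

  Edge : Fin order → Fin order → Set
  Edge u v = T (adj u v)

  field
    symmetric   : ∀ {u v} → Edge u v → Edge v u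
    irreflexive : ∀ {v} → ¬ Edge v v

open OrderedGraph public using (order)

-- Each unordered edge is counted once, through its increasing orientation.
countEdges : ∀ {n} → (Fin n → Fin n → Bool) → ℕ
countEdges {n} adj =
  length (filter (λ (u , v) → (u <? v) ×-dec T? (adj u v))
                 (cartesianProduct (allFin n) (allFin n)))

e : OrderedGraph → ℕ
e G = countEdges (OrderedGraph.adj G)

-- Not necessarily induced, spanning, or nonempty.
record Subgraph (G : OrderedGraph) : Set where
  field
    vertices : Subset (order G)
    adj      : Fin (order G) → Fin (order G) → Bool

  Edge : Fin (order G) → Fin (order G) → Set
  Edge u v = T (adj u v)

  field
    symmetric : ∀ {u v} → Edge u v → Edge v u
    edges⊆    : ∀ {u v} → Edge u v → OrderedGraph.Edge G u v
    endpoints : ∀ {u v} → Edge u v → u ∈ vertices × v ∈ vertices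

eₛ : ∀ {G} → Subgraph G → ℕ
eₛ G′ = countEdges (Subgraph.adj G′)

-- H is regarded as an ordered graph on `vertices`, with the order induced
-- from the ambient graph.
record _Contains_ {G : OrderedGraph} (H : Subgraph G) (F : OrderedGraph) : Set where
  field
    map             : Fin (order F) → Fin (order G)
    into            : ∀ v → map v ∈ Subgraph.vertices H
    injective       : Injective _≡_ _≡_ map
    orderPreserving : map Preserves _≤_ ⟶ _≤_
    edgePreserving  : ∀ {u v} → OrderedGraph.Edge F u v → Subgraph.Edge H (map u) (map v)

_IsFree_ : ∀ {G} → Subgraph G → OrderedGraph → Set
H IsFree F = ¬ (H Contains F)

IsMaximum : (ℚ → Set) → ℚ → Set
IsMaximum S m = S m × (∀ x → S x → x ℚ.≤ m)

-- For sets of rationals and a rational m this agrees with being the infimum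
-- in ℝ, by density of ℚ.
IsInfimum : (ℚ → Set) → ℚ → Set
IsInfimum S m = (∀ x → S x → m ℚ.≤ x) × (∀ b → (∀ x → S x → b ℚ.≤ x) → b ℚ.≤ m)

FreeRatio : (F G : OrderedGraph) .{{_ : NonZero (e G)}} → ℚ → Set
FreeRatio F G q = ∃[ G′ ] (_IsFree_ {G} G′ F × q ≡ (+ eₛ G′) / e G)

-- ρ<(F, G) = q.  The second alternative is the convention max ∅ = 0; it only
-- arises when F has no vertices, since otherwise the subgraph of G without
-- vertices is F-free.
IsRelativeDensity : (F G : OrderedGraph) .{{_ : NonZero (e G)}} → ℚ → Set
IsRelativeDensity F G q =
  IsMaximum (FreeRatio F G) q ⊎ ((¬ ∃ (FreeRatio F G)) × q ≡ 0ℚ)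

-- ρ<(F) = r, for rational r.
IsRelativeTuránDensity : OrderedGraph → ℚ → Set
IsRelativeTuránDensity F =
  IsInfimum (λ q → ∃[ G ] ∃[ nz ] IsRelativeDensity F G {{nz}} q)

HasMonotonePath₂ : OrderedGraph → Set
HasMonotonePath₂ F =
  ∃[ u ] ∃[ v ] ∃[ w ] (u < v × v < w × Edge u v × Edge v w)
  where open OrderedGraph F using (Edge)

{-# OPTIONS --safe #-}
module Submission where

-- If F has a monotone path of length two, then for every G some set of vertices
-- has at least e(G)/4 edges leading upwards from it to its complement. These edges
-- form a subgraph without monotone path of length two, so every density is at
-- least 1/4.
--
-- Conversely, let F have no such path: every vertex has all its neighbours on one
-- side. Let G have as vertices the leaves of the complete B-ary tree of depth K,
-- read from left to right, and its inner nodes, each placed right after its last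
-- leaf, with every leaf joined to all its ancestors. A subgraph G′ gives each leaf
-- a type: the set of depths of the ancestors to which it is still joined. If B is
-- large compared with K 2^K and G′ is not sparse, then some type D of size at least
-- |F| is so frequent that its class contains a comb: a root-to-leaf path such that
-- below every node of the path there is a leaf of the class lying to the right of
-- everything below the deeper nodes of the path. From the deepest depth in D
-- upwards, the i-th leaf so obtained is joined in G′ to the j-th path node for all
-- i ≤ j. Leaves and nodes alternate, so F embeds: vertices with a neighbour to
-- their right go to leaves, all others to nodes.

open import Data.Bool using (Bool; true; false; T; not; _∧_; _∨_; if_then_else_)
open import Data.Bool.Properties using (T?; T-≡; T-∧; T-∨)
open import Data.Fin as Fin using (Fin; zero; suc; toℕ; _↑ˡ_; _↑ʳ_; combine; remQuot; opposite; funToFin; finToFun)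
import Data.Fin.Properties as Fin
import Data.Fin.Subset as Subset
open import Data.Fin.Subset.Properties using (∈⊤)
import Data.Integer as ℤ
import Data.Integer.Properties as ℤ
open import Data.List using (List; []; _∷_; _++_; length; filter; allFin; tabulate; cartesianProduct)
open import Data.List.Membership.Propositional using (_∈_)
open import Data.List.Membership.Propositional.Properties
open import Data.List.Properties using (length-tabulate; length-++)
open import Data.List.Relation.Unary.All as All using (All; []; _∷_)
open import Data.List.Relation.Unary.AllPairs using (_∷_)
open import Data.List.Relation.Unary.Any using (here; there)
open import Data.List.Relation.Unary.Unique.Propositional using (Unique)
import Data.List.Relation.Unary.Unique.Propositional.Properties as Unique
open import Data.Maybe using (Maybe; just; nothing)
open import Data.Nat hiding (_≟_; _/_)
open import Data.Nat.Properties hiding (_≟_)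
open import Data.Nat.Tactic.RingSolver using (solve-∀)
open import Data.Product using (Σ-syntax; ∃; ∃-syntax; ∃₂; _×_; _,_; proj₁; proj₂; map₂; uncurry)
open import Data.Rational as ℚ using (0ℚ; _/_)
import Data.Rational.Properties as ℚ
import Data.Rational.Unnormalised as ℚᵘ
import Data.Rational.Unnormalised.Properties as ℚᵘ
open import Data.Sum as Sum using (_⊎_; inj₁; inj₂)
open import Function using (_∘_; Equivalence; Inverse)
open import Function.Bundles using (_⇔_; mk⇔)
open import Relation.Binary.Definitions using (tri<; tri≈; tri>)
open import Relation.Binary.PropositionalEquality
open import Relation.Nullary
open import Relation.Nullary.Decidable using (⌊_⌋; toWitness; fromWitness; decidable-stable)
open import Relation.Nullary.Decidable.Core using (¬¬-excluded-middle)
open import Algebra.Properties.Semiring.Sum +-*-semiring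
  using (sum; sum-cong-≗; *-distribˡ-sum; ∑-comm; ∑-distrib-+; sum-syntax)
open import Defs

open Equivalence using (to; from)

private variable
  m n k b : ℕ

-- Finite sums and counting

indicator : Bool → ℕ
indicator x = if x then 1 else 0

count : (Fin n → Bool) → ℕ
count A = sum (indicator ∘ A)

indicator≤1 : ∀ x → indicator x ≤ 1
indicator≤1 true  = ≤-refl
indicator≤1 false = z≤n

sum-mono : {f g : Fin n → ℕ} → (∀ i → f i ≤ g i) → sum f ≤ sum g
sum-mono {zero}  f≤g = z≤n
sum-mono {suc n} f≤g = +-mono-≤ (f≤g zero) (sum-mono (f≤g ∘ suc))

sum-const : ∀ n c → sum {n} (λ _ → c) ≡ n * c
sum-const zero    c = refl
sum-const (suc n) c = cong (λ s → c + s) (sum-const n c)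

sum-≤-const : (f : Fin n → ℕ) {c : ℕ} → (∀ i → f i ≤ c) → sum f ≤ n * c
sum-≤-const {n} f {c} f≤c = ≤-trans (sum-mono f≤c) (≤-reflexive (sum-const n c))

count≤n : (A : Fin n → Bool) → count A ≤ n
count≤n {n} A = ≤-trans (sum-≤-const (indicator ∘ A) (indicator≤1 ∘ A)) (≤-reflexive (*-identityʳ n))

term≤sum : (f : Fin n → ℕ) (i : Fin n) → f i ≤ sum f
term≤sum f zero    = m≤m+n _ _
term≤sum f (suc i) = ≤-trans (term≤sum (f ∘ suc) i) (m≤n+m _ _)

sum-positive : (f : Fin n → ℕ) → 0 < sum f → ∃[ i ] 0 < f i
sum-positive {suc n} f 0<sum with f zero in eq
... | suc _ = zero , subst (0 <_) (sym eq) z<s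
... | zero  with i , 0<fi ← sum-positive (f ∘ suc) 0<sum = suc i , 0<fi

indicator-positive : ∀ x → 0 < indicator x → T x
indicator-positive true _ = _

count-positive : (A : Fin n → Bool) → 0 < count A → ∃[ i ] T (A i)
count-positive A 0<c = map₂ (indicator-positive _) (sum-positive (indicator ∘ A) 0<c)

sum-↑ : (f : Fin (m + n) → ℕ) → sum f ≡ sum (λ i → f (i ↑ˡ n)) + sum (λ j → f (m ↑ʳ j))
sum-↑ {zero}  f = refl
sum-↑ {suc m} f = trans (cong (λ s → f zero + s) (sum-↑ {m} (f ∘ suc))) (sym (+-assoc (f zero) _ _))

sum-combine : (f : Fin (m * n) → ℕ) → sum f ≡ sum (λ i → sum (λ j → f (combine {m} {n} i j)))
sum-combine {zero}      f = refl
sum-combine {suc m} {n} f = trans (sum-↑ {n} f)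
  (cong (λ s → sum (λ j → f (j ↑ˡ (m * n))) + s) (sum-combine {m} (λ i → f (n ↑ʳ i))))

-- Leaves of the complete tree, and combs

combine-mono-≤ : {i i′ : Fin m} {j j′ : Fin n} → i Fin.≤ i′ → j Fin.≤ j′ → combine i j Fin.≤ combine i′ j′
combine-mono-≤ {n = n} {i} {i′} {j} {j′} i≤i′ j≤j′
  rewrite Fin.toℕ-combine i j | Fin.toℕ-combine i′ j′ = +-mono-≤ (*-monoʳ-≤ n i≤i′) j≤j′

combine-mono-≤-< : {i i′ : Fin m} {j j′ : Fin n} → i Fin.≤ i′ → j Fin.< j′ → combine i j Fin.< combine i′ j′
combine-mono-≤-< {n = n} {i} {i′} {j} {j′} i≤i′ j<j′
  rewrite Fin.toℕ-combine i j | Fin.toℕ-combine i′ j′ = +-mono-≤-< (*-monoʳ-≤ n i≤i′) j<j′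

-- The elements of Fin (suc b ^ k) are the leaves of the complete (suc b)-ary
-- tree of depth k, from left to right.
Leaf : ℕ → ℕ → Set
Leaf b k = Fin (suc b ^ k)

rightmost : ∀ k → Leaf b k
rightmost     zero    = zero
rightmost {b} (suc k) = combine (Fin.fromℕ b) (rightmost k)

≤-rightmost : ∀ k (x : Leaf b k) → x Fin.≤ rightmost k
≤-rightmost zero zero = z≤n
≤-rightmost {b} (suc k) x with a , t , refl ← Fin.combine-surjective {suc b} {suc b ^ k} x =
  combine-mono-≤ (Fin.≤fromℕ a) (≤-rightmost k t)

-- The rightmost leaf below the ancestor of x at depth h; an inner node of the tree
-- is represented by this leaf and its depth. The root has depth zero.
last : Fin k → Leaf b k → Leaf b k
last {suc k}     zero    x = rightmost (suc k)
last {suc k} {b} (suc h) x = uncurry (λ a t → combine a (last h t)) (remQuot {suc b} (suc b ^ k) x)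

last-combine : (h : Fin k) (a : Fin (suc b)) (t : Leaf b k) → last (suc h) (combine a t) ≡ combine a (last h t)
last-combine h a t = cong (uncurry (λ a t → combine a (last h t))) (Fin.remQuot-combine a t)

≤-last : (h : Fin k) (x : Leaf b k) → x Fin.≤ last h x
≤-last {suc k}     zero    x = ≤-rightmost (suc k) x
≤-last {suc k} {b} (suc h) x with a , t , refl ← Fin.combine-surjective {suc b} {suc b ^ k} x =
  subst (combine a t Fin.≤_) (sym (last-combine h a t)) (combine-mono-≤ (Fin.≤-refl {x = a}) (≤-last h t))

-- spine h is the node of the path at depth h, and tooth h a leaf of A below it.
record Comb b k (A : Leaf b k → Bool) : Set where
  field
    tooth       : Fin k → Leaf b k
    spine       : Fin k → Leaf b k
    tooth∈      : ∀ h → T (A (tooth h))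
    last-tooth  : ∀ {h h′} → h′ Fin.≤ h → last h′ (tooth h) ≡ spine h′
    spine<tooth : ∀ {h h′} → h Fin.< h′ → spine h′ Fin.< tooth h

  tooth≤spine : ∀ h → tooth h Fin.≤ spine h
  tooth≤spine h = subst (tooth h Fin.≤_) (last-tooth (Fin.≤-refl {x = h})) (≤-last h (tooth h))

-- The path enters child `a`, and a leaf below a later child `a′` becomes the tooth at the root: it
-- lies to the right of everything below `a`, hence of all deeper nodes of the path.
extendComb : (A : Leaf b (suc k) → Bool) {a a′ : Fin (suc b)} → a Fin.< a′ → (t : Leaf b k) →
             T (A (combine a′ t)) → Comb b k (λ x → A (combine a x)) → Comb b (suc k) A
extendComb {b} {k} A {a} {a′} a<a′ t t∈ C = record
  { tooth = tooth ; spine = spine ; tooth∈ = tooth∈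
  ; last-tooth = λ {h} {h′} → last-tooth h h′ ; spine<tooth = λ {h} {h′} → spine<tooth h h′ }
  where
  module C = Comb C

  tooth spine : Fin (suc k) → Leaf b (suc k)
  tooth zero    = combine a′ t
  tooth (suc h) = combine a (C.tooth h)
  spine zero    = rightmost (suc k)
  spine (suc h) = combine a (C.spine h)

  tooth∈ : ∀ h → T (A (tooth h))
  tooth∈ zero    = t∈
  tooth∈ (suc h) = C.tooth∈ h

  last-tooth : ∀ h h′ → h′ Fin.≤ h → last h′ (tooth h) ≡ spine h′
  last-tooth h       zero     _          = refl
  last-tooth (suc h) (suc h′) (s≤s h′≤h) =
    trans (last-combine h′ a (C.tooth h)) (cong (combine a) (C.last-tooth h′≤h))

  spine<tooth : ∀ h h′ → h Fin.< h′ → spine h′ Fin.< tooth h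
  spine<tooth zero    (suc h′) _          = Fin.combine-monoˡ-< (C.spine h′) t a<a′
  spine<tooth (suc h) (suc h′) (s<s h<h′) = combine-mono-≤-< (Fin.≤-refl {x = a}) (C.spine<tooth h<h′)

-- Without such a pair, consider the first index with `P`, if there is one: it contributes at most
-- `C`, all earlier ones at most `B` each, and all later ones nothing.
pair-or-sum≤ : (P : Fin n → Set) (c : Fin n → ℕ) {B C : ℕ} →
               (∀ a → P a ⊎ c a ≤ B) → (∀ a → c a ≤ C) →
               (∃₂ λ a a′ → a Fin.< a′ × P a × 0 < c a′) ⊎ sum c ≤ C + n * B
pair-or-sum≤ {zero}  P c _ _ = inj₂ z≤n
pair-or-sum≤ {suc n} P c {B} {C} P⊎c≤B c≤C with P⊎c≤B zero
... | inj₁ p with sum (c ∘ suc) in eq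
...   | suc _ with i , 0<ci ← sum-positive (c ∘ suc) (subst (0 <_) (sym eq) z<s) = inj₁ (zero , suc i , z<s , p , 0<ci)
...   | zero  = inj₂ (≤-trans (≤-reflexive (+-identityʳ _)) (≤-trans (c≤C zero) (m≤m+n C _)))
pair-or-sum≤ {suc n} P c {B} {C} P⊎c≤B c≤C | inj₂ c₀≤B
  with pair-or-sum≤ (P ∘ suc) (c ∘ suc) (P⊎c≤B ∘ suc) (c≤C ∘ suc)
... | inj₁ (a , a′ , a<a′ , p , pos) = inj₁ (suc a , suc a′ , s<s a<a′ , p , pos)
... | inj₂ sum≤ = inj₂ (≤-trans (+-mono-≤ c₀≤B sum≤) (≤-reflexive (swap-first B C (n * B))))
  where
  swap-first : ∀ x y z → x + (y + z) ≡ y + (x + z)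
  swap-first = solve-∀

*-positiveʳ : ∀ m → 0 < m * n → 0 < n
*-positiveʳ {zero}  m 0<m*0 rewrite *-zeroʳ m = 0<m*0
*-positiveʳ {suc n} m _     = z<s

fibre : ∀ k → (Leaf b (suc k) → Bool) → Fin (suc b) → Leaf b k → Bool
fibre k A a t = A (combine a t)

-- Induction on the depth. If a comb below one child cannot be extended by a leaf below a later
-- child, at most one child exceeds the inductive bound. Filling that child completely adds
-- `suc b ^ suc k`, the extra summand of `suc k * suc b ^ suc k`.
comb-or-sparse : ∀ k (A : Leaf b k → Bool) → Comb b k A ⊎ suc b * count A ≤ k * suc b ^ k
comb-or-sparse zero A = inj₁ record
  { tooth = λ () ; spine = λ () ; tooth∈ = λ () ; last-tooth = λ { {()} } ; spine<tooth = λ { {()} } }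
comb-or-sparse {b} (suc k) A with
  pair-or-sum≤ (λ a → Comb b k (fibre k A a)) (λ a → suc b * count (fibre k A a))
    (λ a → comb-or-sparse k (fibre k A a)) (λ a → *-monoʳ-≤ (suc b) (count≤n (fibre k A a)))
... | inj₁ (a , a′ , a<a′ , C , 0<c) with t , t∈ ← count-positive (fibre k A a′) (*-positiveʳ (suc b) 0<c) =
  inj₁ (extendComb A a<a′ t t∈ C)
... | inj₂ sum≤ = inj₂ (begin
  suc b * count A                                  ≡⟨ cong (suc b *_) (sum-combine {suc b} (indicator ∘ A)) ⟩
  suc b * ∑[ a < suc b ] count (fibre k A a)       ≡⟨ *-distribˡ-sum (suc b) (λ a → count (fibre k A a)) ⟩
  ∑[ a < suc b ] (suc b * count (fibre k A a))     ≤⟨ sum≤ ⟩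
  suc b * suc b ^ k + suc b * (k * suc b ^ k)      ≡⟨ regroup (suc b) k (suc b ^ k) ⟩
  suc k * suc b ^ suc k                            ∎)
  where
  open ≤-Reasoning
  regroup : ∀ b k M → b * M + b * (k * M) ≡ (1 + k) * (b * M)
  regroup = solve-∀

-- Leaf types, and combs of a single type

∃-or-∀ : {P Q : Fin n → Set} → (∀ i → P i ⊎ Q i) → ∃ P ⊎ (∀ i → Q i)
∃-or-∀ {zero}  _   = inj₂ λ ()
∃-or-∀ {suc n} P⊎Q with P⊎Q zero | ∃-or-∀ (P⊎Q ∘ suc)
... | inj₁ p | _             = inj₁ (zero , p)
... | inj₂ _ | inj₁ (i , p)  = inj₁ (suc i , p)
... | inj₂ q | inj₂ qs       = inj₂ λ { zero → q ; (suc i) → qs i }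

-- Numbers the types, so that `sum` can range over all of them.
encode : (Fin k → Bool) → Fin (2 ^ k)
encode D = funToFin (λ i → Inverse.from Fin.2↔Bool (D i))

encode-injective : (D D′ : Fin k → Bool) → encode D ≡ encode D′ → ∀ i → D i ≡ D′ i
encode-injective D D′ eq i = begin
  D i                                     ≡⟨ Inverse.strictlyInverseˡ Fin.2↔Bool (D i) ⟨
  decode (Inverse.from Fin.2↔Bool (D i))  ≡⟨ cong decode (Fin.finToFun-funToFin _ i) ⟨
  decode (finToFun (encode D) i)          ≡⟨ cong (λ c → decode (finToFun c i)) eq ⟩
  decode (finToFun (encode D′) i)         ≡⟨ cong decode (Fin.finToFun-funToFin _ i) ⟩
  decode (Inverse.from Fin.2↔Bool (D′ i)) ≡⟨ Inverse.strictlyInverseˡ Fin.2↔Bool (D′ i) ⟩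
  D′ i                                    ∎
  where
  open ≡-Reasoning
  decode = Inverse.to Fin.2↔Bool

indicator-true : ∀ {x} → T x → indicator x ≡ 1
indicator-true {true} _ = refl

module _ (k n : ℕ) (S : Leaf b (suc k) → Fin (suc k) → Bool) where

  private
    K = suc k
    M = suc b ^ K

  large : Leaf b K → Bool
  large x = ⌊ n ≤? count (S x) ⌋

  class : Fin (2 ^ K) → Leaf b K → Bool
  class c x = ⌊ encode (S x) Fin.≟ c ⌋ ∧ large x

  HomogeneousComb : Set
  HomogeneousComb = ∃[ A ] Σ[ C ∈ Comb b K A ] ∃[ D ]
    n ≤ count D × (∀ h i → S (Comb.tooth C h) i ≡ D i)

  -- The type of the tooth at depth zero represents the common type; the depth is a successor so
  -- that this tooth exists.
  class-comb : ∀ {c} → Comb b K (class c) → HomogeneousComb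
  class-comb {c} C = class c , C , S (tooth zero) ,
    toWitness (proj₂ (in-class zero)) ,
    λ h → encode-injective (S (tooth h)) (S (tooth zero))
            (trans (toWitness (proj₁ (in-class h))) (sym (toWitness (proj₁ (in-class zero)))))
    where
    open Comb C
    in-class : ∀ h → T ⌊ encode (S (tooth h)) Fin.≟ c ⌋ × T (large (tooth h))
    in-class h = to T-∧ (tooth∈ h)

  -- A leaf of small type is paid for by `n`. Any other leaf lies in the class of its own type,
  -- which pays `K`.
  count-S≤ : ∀ x → count (S x) ≤ n + K * ∑[ c < 2 ^ K ] indicator (class c x)
  count-S≤ x with ≤-total n (count (S x))
  ... | inj₂ ≤n = ≤-trans ≤n (m≤m+n n _)
  ... | inj₁ n≤ = begin
    count (S x)                                        ≤⟨ count≤n (S x) ⟩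
    K                                                  ≡⟨ *-identityʳ K ⟨
    K * 1                                              ≡⟨ cong (K *_) (indicator-true (in-class n≤)) ⟨
    K * indicator (class (encode (S x)) x)             ≤⟨ *-monoʳ-≤ K (term≤sum (λ c → indicator (class c x)) _) ⟩
    K * ∑[ c < 2 ^ K ] indicator (class c x)           ≤⟨ m≤n+m _ n ⟩
    n + K * ∑[ c < 2 ^ K ] indicator (class c x)       ∎
    where
    open ≤-Reasoning
    in-class : n ≤ count (S x) → T (class (encode (S x)) x)
    in-class n≤ = from (T-∧ {⌊ encode (S x) Fin.≟ encode (S x) ⌋}) (fromWitness refl , fromWitness n≤)

  -- If no class contains a comb, `comb-or-sparse` bounds each of the `2 ^ K` classes; summing
  -- `count-S≤` over the leaves and exchanging the sums brings in the class sizes.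
  homogeneousComb-or-sparse : HomogeneousComb ⊎
    suc b * ∑[ x < M ] count (S x) ≤ suc b * (n * M) + K * (2 ^ K * (K * M))
  homogeneousComb-or-sparse with ∃-or-∀ (λ c → comb-or-sparse K (class c))
  ... | inj₁ (c , C) = inj₁ (class-comb C)
  ... | inj₂ sparse  = inj₂ (begin
    suc b * ∑[ x < M ] count (S x)
      ≤⟨ *-monoʳ-≤ (suc b) (sum-mono count-S≤) ⟩
    suc b * ∑[ x < M ] (n + K * ∑[ c < 2 ^ K ] indicator (class c x))
      ≡⟨ cong (suc b *_) (∑-distrib-+ {M} (λ _ → n) _) ⟩
    suc b * (∑[ x < M ] n + ∑[ x < M ] (K * ∑[ c < 2 ^ K ] indicator (class c x)))
      ≡⟨ cong₂ (λ s t → suc b * (s + t)) (trans (sum-const M n) (*-comm M n)) (sym (*-distribˡ-sum {M} K _)) ⟩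
    suc b * (n * M + K * ∑[ x < M ] ∑[ c < 2 ^ K ] indicator (class c x))
      ≡⟨ cong (λ s → suc b * (n * M + K * s)) (∑-comm {M} {2 ^ K} _) ⟩
    suc b * (n * M + K * ∑[ c < 2 ^ K ] count (class c))
      ≡⟨ regroup (suc b) (n * M) K _ ⟩
    suc b * (n * M) + K * (suc b * ∑[ c < 2 ^ K ] count (class c))
      ≡⟨ cong (λ s → suc b * (n * M) + K * s) (*-distribˡ-sum {2 ^ K} (suc b) _) ⟩
    suc b * (n * M) + K * (∑[ c < 2 ^ K ] (suc b * count (class c)))
      ≤⟨ +-monoʳ-≤ (suc b * (n * M)) (*-monoʳ-≤ K (sum-≤-const _ sparse)) ⟩
    suc b * (n * M) + K * (2 ^ K * (K * M)) ∎)
    where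
    open ≤-Reasoning
    regroup : ∀ b x K y → b * (x + K * y) ≡ b * x + K * (b * y)
    regroup = solve-∀

-- Increasing enumerations and lists of edges

select : (D : Fin k → Bool) → n ≤ count D →
         Σ[ h ∈ (Fin n → Fin k) ] (∀ {i j} → i Fin.< j → h i Fin.< h j) × (∀ i → T (D (h i)))
select {n = zero} D _ = (λ ()) , (λ { {()} }) , λ ()
select {suc k} {suc n} D n≤ with D zero in eq
... | false with h , mono , h∈ ← select (D ∘ suc) n≤ = suc ∘ h , (λ i<j → s<s (mono i<j)) , h∈
... | true with h , mono , h∈ ← select (D ∘ suc) (s≤s⁻¹ n≤) = h′ , mono′ , h′∈
  where
  h′ : Fin (suc n) → Fin (suc k)
  h′ zero    = zero
  h′ (suc i) = suc (h i)
  mono′ : ∀ {i j} → i Fin.< j → h′ i Fin.< h′ j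
  mono′ {zero}  {suc j} _         = z<s
  mono′ {suc i} {suc j} (s<s i<j) = s<s (mono i<j)
  h′∈ : ∀ i → T (D (h′ i))
  h′∈ zero    = from T-≡ eq
  h′∈ (suc i) = h∈ i

opposite-antitone-< : {i j : Fin n} → i Fin.< j → opposite j Fin.< opposite i
opposite-antitone-< {n} {i} {j} i<j rewrite Fin.opposite-prop i | Fin.opposite-prop j =
  ∸-monoʳ-< (s<s i<j) (Fin.toℕ<n j)

-- Delete one occurrence of the head from `ys`; uniqueness keeps the remaining elements of `xs` in
-- what is left. Comparisons between numbers of edges rest on this.
length-mono-⊆ : {A : Set} {xs ys : List A} → Unique xs → (∀ {z} → z ∈ xs → z ∈ ys) → length xs ≤ length ys
length-mono-⊆ {xs = []}     _            _     = z≤n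
length-mono-⊆ {xs = x ∷ xs} (x∉xs ∷ xs!) xs⊆ys with as , bs , refl ← ∈-∃++ (xs⊆ys (here refl)) = begin
  suc (length xs)              ≤⟨ s≤s (length-mono-⊆ xs! xs⊆as++bs) ⟩
  suc (length (as ++ bs))      ≡⟨ cong suc (length-++ as) ⟩
  suc (length as + length bs)  ≡⟨ +-suc (length as) (length bs) ⟨
  length as + suc (length bs)  ≡⟨ length-++ as ⟨
  length (as ++ x ∷ bs)        ∎
  where
  open ≤-Reasoning
  xs⊆as++bs : ∀ {z} → z ∈ xs → z ∈ as ++ bs
  xs⊆as++bs z∈xs with ∈-++⁻ as (xs⊆ys (there z∈xs))
  ... | inj₁ z∈as         = ∈-++⁺ˡ z∈as
  ... | inj₂ (there z∈bs) = ∈-++⁺ʳ as z∈bs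
  ... | inj₂ (here refl)  = contradiction refl (All.lookup x∉xs z∈xs)

length-filter-tabulate : {A : Set} (B : A → Bool) (f : Fin n → A) →
                         length (filter (T? ∘ B) (tabulate f)) ≡ count (B ∘ f)
length-filter-tabulate {zero}  B f = refl
length-filter-tabulate {suc n} B f with B (f zero)
... | true  = cong suc (length-filter-tabulate B (f ∘ suc))
... | false = length-filter-tabulate B (f ∘ suc)

module _ (adj : Fin n → Fin n → Bool) where

  edges : List (Fin n × Fin n)
  edges = filter (λ (u , v) → (u Fin.<? v) ×-dec T? (adj u v)) (cartesianProduct (allFin n) (allFin n))

  edges-unique : Unique edges
  edges-unique = Unique.filter⁺ _ (Unique.cartesianProduct⁺ (Unique.allFin⁺ n) (Unique.allFin⁺ n))

  ∈-edges⁺ : ∀ {u v} → u Fin.< v → T (adj u v) → (u , v) ∈ edges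
  ∈-edges⁺ u<v uv = ∈-filter⁺ _ (∈-cartesianProduct⁺ (∈-allFin _) (∈-allFin _)) (u<v , uv)

  ∈-edges⁻ : ∀ {u v} → (u , v) ∈ edges → u Fin.< v × T (adj u v)
  ∈-edges⁻ uv∈ = proj₂ (∈-filter⁻ _ {xs = cartesianProduct (allFin n) (allFin n)} uv∈)

-- The leaf-ancestor graph and embeddings into its subgraphs

-- combine x zero is the leaf x, and combine y (suc h) the inner node of depth h with
-- last leaf y. The latter is an isolated vertex if y is not last below its ancestor.
module AncestorGraph (b K : ℕ) where

  M : ℕ
  M = suc b ^ K

  Vertex : Set
  Vertex = Fin (M * suc K)

  leaf : Leaf b K → Vertex
  leaf x = combine x zero

  node : Leaf b K → Fin K → Vertex
  node y h = combine y (suc h)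

  arc : Leaf b K × Fin (suc K) → Leaf b K × Fin (suc K) → Bool
  arc (x , zero) (y , suc h) = ⌊ last h x Fin.≟ y ⌋
  arc (x , zero) (y , zero)  = false
  arc (x , suc _) _          = false

  adj : Vertex → Vertex → Bool
  adj u v = arc (remQuot (suc K) u) (remQuot (suc K) v) ∨ arc (remQuot (suc K) v) (remQuot (suc K) u)

  leaf<node : ∀ {x y} h → x Fin.≤ y → leaf x Fin.< node y h
  leaf<node h x≤y = combine-mono-≤-< x≤y z<s

  arc-irreflexive : ∀ p → ¬ T (arc p p)
  arc-irreflexive (_ , zero)  ()
  arc-irreflexive (_ , suc _) ()

  graph : OrderedGraph
  graph = record
    { order       = M * suc K
    ; adj         = adj
    ; symmetric   = λ {u} {v} uv → from T-∨ (Sum.swap (to (T-∨ {arc (remQuot (suc K) u) (remQuot (suc K) v)}) uv))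
    ; irreflexive = λ {v} vv → Sum.[ arc-irreflexive (remQuot (suc K) v) , arc-irreflexive (remQuot (suc K) v) ]′ (to T-∨ vv)
    }

  leaf-node-edge : ∀ x h → T (adj (leaf x) (node (last h x) h))
  leaf-node-edge x h rewrite Fin.remQuot-combine x (zero {n = K}) | Fin.remQuot-combine (last h x) (suc h) =
    from (T-∨ {⌊ last h x Fin.≟ last h x ⌋}) (inj₁ (fromWitness refl))

  arc⁻ : ∀ u v → T (arc (remQuot (suc K) u) (remQuot (suc K) v)) →
         ∃₂ λ x h → u ≡ leaf x × v ≡ node (last h x) h
  arc⁻ u v uv with Fin.combine-surjective {M} {suc K} u | Fin.combine-surjective {M} {suc K} v
  ... | x , i , refl | y , j , refl = arc-combine x i y j
          (subst₂ (λ p q → T (arc p q)) (Fin.remQuot-combine x i) (Fin.remQuot-combine y j) uv)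
    where
    arc-combine : ∀ x i y j → T (arc (x , i) (y , j)) →
                  ∃₂ λ x′ h → combine x i ≡ leaf x′ × combine y j ≡ node (last h x′) h
    arc-combine x zero y (suc h) xy = x , h , refl , cong (λ z → node z h) (sym (toWitness xy))

  -- A leaf precedes all its ancestors, so the lower end of an edge is always the leaf.
  edge⁻ : ∀ {u v} → u Fin.< v → T (adj u v) → ∃₂ λ x h → u ≡ leaf x × v ≡ node (last h x) h
  edge⁻ {u} {v} u<v uv with to (T-∨ {arc (remQuot (suc K) u) (remQuot (suc K) v)}) uv
  ... | inj₁ uv = arc⁻ u v uv
  ... | inj₂ vu with x , h , refl , refl ← arc⁻ v u vu =
    contradiction (leaf<node h (≤-last h x)) (<-asym u<v)

  -- A leaf has one ancestor at each depth, so leaf and depth together index every edge exactly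
  -- once.
  leaf-node : Fin (M * K) → Vertex × Vertex
  leaf-node i = uncurry (λ x h → leaf x , node (last h x) h) (remQuot K i)

  leaf-node-combine : ∀ x h → leaf-node (combine x h) ≡ (leaf x , node (last h x) h)
  leaf-node-combine x h = cong (uncurry (λ x h → leaf x , node (last h x) h)) (Fin.remQuot-combine x h)

  leaf-node-injective : ∀ {i j} → leaf-node i ≡ leaf-node j → i ≡ j
  leaf-node-injective {i} {j} eq
    with Fin.combine-surjective {M} {K} i | Fin.combine-surjective {M} {K} j
  ... | x , h , refl | y , g , refl =
    let eq′ = trans (sym (leaf-node-combine x h)) (trans eq (leaf-node-combine y g))
    in cong₂ combine (Fin.combine-injectiveˡ x zero y zero (cong proj₁ eq′))
         (Fin.suc-injective (Fin.combine-injectiveʳ (last h x) (suc h) (last g y) (suc g) (cong proj₂ eq′)))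

  e≥ : M * K ≤ e graph
  e≥ = ≤-trans (≤-reflexive (sym (length-tabulate leaf-node)))
         (length-mono-⊆ (Unique.tabulate⁺ leaf-node-injective) ⊆edges)
    where
    ⊆edges : ∀ {p} → p ∈ tabulate leaf-node → p ∈ edges adj
    ⊆edges p∈ with ∈-tabulate⁻ p∈
    ... | i , refl with Fin.combine-surjective {M} {K} i
    ... | x , h , refl = subst (_∈ edges adj) (sym (leaf-node-combine x h))
                           (∈-edges⁺ adj (leaf<node h (≤-last h x)) (leaf-node-edge x h))

  module _ (G′ : Subgraph graph) where
    private module G′ = Subgraph G′

    -- The type of a leaf with respect to `G′`.
    levels : Leaf b K → Fin K → Bool
    levels x h = G′.adj (leaf x) (node (last h x) h)

    eₛ≤ : eₛ G′ ≤ ∑[ x < M ] count (levels x)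
    eₛ≤ = begin
      eₛ G′
        ≤⟨ length-mono-⊆ (edges-unique G′.adj) edges⊆ ⟩
      length (filter (T? ∘ uncurry G′.adj) (tabulate leaf-node))
        ≡⟨ length-filter-tabulate (uncurry G′.adj) leaf-node ⟩
      count (uncurry G′.adj ∘ leaf-node)
        ≡⟨ sum-combine {M} {K} (indicator ∘ uncurry G′.adj ∘ leaf-node) ⟩
      ∑[ x < M ] ∑[ h < K ] indicator (uncurry G′.adj (leaf-node (combine x h)))
        ≡⟨ sum-cong-≗ (λ x → sum-cong-≗ (λ h → cong (indicator ∘ uncurry G′.adj) (leaf-node-combine x h))) ⟩
      ∑[ x < M ] count (levels x) ∎
      where
      open ≤-Reasoning
      edges⊆ : ∀ {p} → p ∈ edges G′.adj → p ∈ filter (T? ∘ uncurry G′.adj) (tabulate leaf-node)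
      edges⊆ p∈ with u<v , uv ← ∈-edges⁻ G′.adj p∈ with x , h , refl , refl ← edge⁻ u<v (G′.edges⊆ uv) =
        ∈-filter⁺ (T? ∘ uncurry G′.adj)
          (subst (_∈ tabulate leaf-node) (leaf-node-combine x h) (∈-tabulate⁺ (combine x h))) uv

    comb⇒contains : (F : OrderedGraph) → ¬ HasMonotonePath₂ F →
                    ∀ {A} (C : Comb b K A) (D : Fin K → Bool) → order F ≤ count D →
                    (∀ h i → levels (Comb.tooth C h) i ≡ D i) → G′ Contains F
    comb⇒contains F noPath C D orderF≤ homogeneous = record
      { map             = vertex
      ; into            = into
      ; injective       = injective
      ; orderPreserving = orderPreserving
      ; edgePreserving  = edgePreserving
      }
      where
      open Comb C
      module F = OrderedGraph F

      -- Teeth at smaller depth lie further to the right, so the depths in `D` are assigned in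
      -- reverse: later vertices of `F` get smaller depths.
      h : Fin (order F) → Fin K
      h i = proj₁ (select D orderF≤) (opposite i)

      h-antitone : ∀ {i j} → i Fin.< j → h j Fin.< h i
      h-antitone i<j = proj₁ (proj₂ (select D orderF≤)) (opposite-antitone-< i<j)

      D∋h : ∀ i → T (D (h i))
      D∋h i = proj₂ (proj₂ (select D orderF≤)) (opposite i)

      -- The path node at depth `h j` is an ancestor of the tooth at depth `h i`, and `h j` belongs
      -- to `D`, the type of that tooth.
      tooth-spine-edge : ∀ {i j} → h j Fin.≤ h i → G′.Edge (leaf (tooth (h i))) (node (spine (h j)) (h j))
      tooth-spine-edge {i} {j} hj≤hi = subst (λ y → G′.Edge (leaf (tooth (h i))) (node y (h j))) (last-tooth hj≤hi)
        (subst T (sym (homogeneous (h i) (h j))) (D∋h j))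

      HasRightNeighbour : Fin (order F) → Set
      HasRightNeighbour i = ∃[ j ] (i Fin.< j × F.Edge i j)

      hasRightNeighbour? : ∀ i → Dec (HasRightNeighbour i)
      hasRightNeighbour? i = Fin.any? λ j → (i Fin.<? j) ×-dec T? (F.adj i j)

      vertex : Fin (order F) → Vertex
      vertex i with hasRightNeighbour? i
      ... | yes _ = leaf (tooth (h i))
      ... | no  _ = node (spine (h i)) (h i)

      -- Isolated vertices of `F` must land in `G′` as well. The tooth and the path node at depth
      -- `h i` are joined in `G′`, so both belong to it.
      into : ∀ i → vertex i Subset.∈ G′.vertices
      into i with hasRightNeighbour? i
      ... | yes _ = proj₁ (G′.endpoints (tooth-spine-edge {i} {i} ≤-refl))
      ... | no  _ = proj₂ (G′.endpoints (tooth-spine-edge {i} {i} ≤-refl))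

      -- Whether `i` goes to a leaf or to a node, its position lies between the tooth and the path
      -- node at depth `h i`. By `spine<tooth` these intervals are disjoint for different `i` and
      -- follow the order of `F`.
      tooth≤vertex≤spine : ∀ i → ∃₂ λ p s → vertex i ≡ combine p s × tooth (h i) Fin.≤ p × p Fin.≤ spine (h i)
      tooth≤vertex≤spine i with hasRightNeighbour? i
      ... | yes _ = _ , _ , refl , Fin.≤-refl {x = tooth (h i)} , tooth≤spine (h i)
      ... | no  _ = _ , _ , refl , tooth≤spine (h i) , Fin.≤-refl {x = spine (h i)}

      vertex-mono-< : ∀ {i j} → i Fin.< j → vertex i Fin.< vertex j
      vertex-mono-< {i} {j} i<j with tooth≤vertex≤spine i | tooth≤vertex≤spine j
      ... | p , s , eqᵢ , _ , p≤ | q , t , eqⱼ , ≤q , _ rewrite eqᵢ | eqⱼ =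
        Fin.combine-monoˡ-< s t (<-≤-trans (≤-<-trans p≤ (spine<tooth (h-antitone i<j))) ≤q)

      injective : ∀ {i j} → vertex i ≡ vertex j → i ≡ j
      injective {i} {j} eq with Fin.<-cmp i j
      ... | tri< i<j _ _ = contradiction eq (Fin.<⇒≢ (vertex-mono-< i<j))
      ... | tri≈ _ i≡j _ = i≡j
      ... | tri> _ _ j<i = contradiction (sym eq) (Fin.<⇒≢ (vertex-mono-< j<i))

      orderPreserving : ∀ {i j} → i Fin.≤ j → vertex i Fin.≤ vertex j
      orderPreserving {i} {j} i≤j with Fin.<-cmp i j
      ... | tri< i<j _ _ = <⇒≤ (vertex-mono-< i<j)
      ... | tri≈ _ refl _ = ≤-refl
      ... | tri> _ _ j<i = contradiction j<i (≤⇒≯ i≤j)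

      edge-< : ∀ {i j} → i Fin.< j → F.Edge i j → G′.Edge (vertex i) (vertex j)
      edge-< {i} {j} i<j ij with hasRightNeighbour? i | hasRightNeighbour? j
      ... | yes _  | no _              = tooth-spine-edge {i} {j} (<⇒≤ (h-antitone i<j))
      ... | no ¬rᵢ | _                 = contradiction (j , i<j , ij) ¬rᵢ
      ... | yes _  | yes (l , j<l , jl) = contradiction (i , j , l , i<j , j<l , ij , jl) noPath

      edgePreserving : ∀ {i j} → F.Edge i j → G′.Edge (vertex i) (vertex j)
      edgePreserving {i} {j} ij with Fin.<-cmp i j
      ... | tri< i<j _ _  = edge-< i<j ij
      ... | tri≈ _ refl _ = contradiction ij F.irreflexive
      ... | tri> _ _ j<i  = G′.symmetric (edge-< j<i (F.symmetric ij))

-- Choice of the parameters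

sparse-free-subgraphs : (F : OrderedGraph) → ¬ HasMonotonePath₂ F → ∀ t →
  ∃[ G ] NonZero (e G) × (∀ (G′ : Subgraph G) → G′ IsFree F → t * eₛ G′ ≤ e G)
sparse-free-subgraphs F noPath t = graph , >-nonZero (<-≤-trans M*K>0 e≥) , bound
  where
  -- K makes the leaves of small type, and β those of infrequent type, account for
  -- at most a fraction 1 / 2t of the edges each.
  K β : ℕ
  K = suc (2 * t * order F)
  β = 2 * t * K * 2 ^ K
  open AncestorGraph β K

  M*K>0 : 0 < M * K
  M*K>0 = *-mono-≤ (m^n>0 (suc β) K) (s≤s (z≤n {2 * t * order F}))

  regroup₁ : ∀ t B S → (2 * B) * (t * S) ≡ 2 * t * (B * S)
  regroup₁ = solve-∀
  regroup₂ : ∀ t B n M K C → 2 * t * (B * (n * M) + K * (C * (K * M))) ≡ B * M * (2 * t * n) + K * M * (2 * t * K * C)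
  regroup₂ = solve-∀
  regroup₃ : ∀ B M K → B * M * K + K * M * B ≡ (2 * B) * (M * K)
  regroup₃ = solve-∀

  bound : (G′ : Subgraph graph) → G′ IsFree F → t * eₛ G′ ≤ e graph
  bound G′ free with homogeneousComb-or-sparse (2 * t * order F) (order F) (levels G′)
  ... | inj₁ (_ , C , D , n≤ , homogeneous) = contradiction (comb⇒contains G′ F noPath C D n≤ homogeneous) free
  ... | inj₂ sparse = ≤-trans (≤-trans (*-monoʳ-≤ t (eₛ≤ G′)) (*-cancelˡ-≤ (2 * suc β) (begin
    (2 * suc β) * (t * ∑[ x < M ] count (levels G′ x))                ≡⟨ regroup₁ t (suc β) _ ⟩
    2 * t * (suc β * ∑[ x < M ] count (levels G′ x))                  ≤⟨ *-monoʳ-≤ (2 * t) sparse ⟩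
    2 * t * (suc β * (order F * M) + K * (2 ^ K * (K * M)))           ≡⟨ regroup₂ t (suc β) (order F) M K (2 ^ K) ⟩
    -- By choice of the parameters, `K` and `suc β` exceed the last factors of the two summands by
    -- one, so each summand is at most `suc β * M * K`.
    suc β * M * (2 * t * order F) + K * M * (2 * t * K * 2 ^ K)       ≤⟨ +-mono-≤ (*-monoʳ-≤ (suc β * M) (n≤1+n (2 * t * order F)))
                                                                                  (*-monoʳ-≤ (K * M) (n≤1+n β)) ⟩
    suc β * M * K + K * M * suc β                                     ≡⟨ regroup₃ (suc β) M K ⟩
    (2 * suc β) * (M * K)                                             ∎))) e≥
    where open ≤-Reasoning

-- Comparing fractions, and maxima of bounded sets

/-mono : ∀ a c b d .{{_ : NonZero b}} .{{_ : NonZero d}} → a * d ≤ c * b → (ℤ.+ a) / b ℚ.≤ (ℤ.+ c) / d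
/-mono a c (suc b) (suc d) ad≤cb = ℚ.toℚᵘ-cancel-≤ (ℚᵘ.≤-respˡ-≃ (ℚᵘ.≃-sym (ℚ.toℚᵘ-fromℚᵘ (ℚᵘ.mkℚᵘ (ℤ.+ a) b)))
  (ℚᵘ.≤-respʳ-≃ (ℚᵘ.≃-sym (ℚ.toℚᵘ-fromℚᵘ (ℚᵘ.mkℚᵘ (ℤ.+ c) d)))
    (ℚᵘ.*≤* (subst₂ ℤ._≤_ (ℤ.pos-* a (suc d)) (ℤ.pos-* c (suc b)) (ℤ.+≤+ ad≤cb)))))

/-reflects : ∀ a c b d .{{_ : NonZero b}} .{{_ : NonZero d}} → (ℤ.+ a) / b ℚ.≤ (ℤ.+ c) / d → a * d ≤ c * b
/-reflects a c (suc b) (suc d) a/b≤c/d with ℚᵘ.≤-respˡ-≃ (ℚ.toℚᵘ-fromℚᵘ (ℚᵘ.mkℚᵘ (ℤ.+ a) b))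
  (ℚᵘ.≤-respʳ-≃ (ℚ.toℚᵘ-fromℚᵘ (ℚᵘ.mkℚᵘ (ℤ.+ c) d)) (ℚ.toℚᵘ-mono-≤ a/b≤c/d))
... | ℚᵘ.*≤* p = ℤ.drop‿+≤+ (subst₂ ℤ._≤_ (sym (ℤ.pos-* a (suc d))) (sym (ℤ.pos-* c (suc b))) p)

-- A positive fraction has numerator at least one, so its own denominator serves.
unit-fraction-below : ∀ q → ¬ (q ℚ.≤ 0ℚ) → ∃[ t ] (ℤ.+ 1) / suc t ℚ.≤ q
unit-fraction-below (ℚ.mkℚ ℤ.-[1+ _ ] _ _) q≰0 = contradiction (ℚ.*≤* ℤ.-≤+) q≰0
unit-fraction-below (ℚ.mkℚ (ℤ.+ 0) _ _)    q≰0 = contradiction (ℚ.*≤* (ℤ.+≤+ z≤n)) q≰0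
unit-fraction-below q@(ℚ.mkℚ (ℤ.+ suc a) d _) _ =
  d , subst ((ℤ.+ 1) / suc d ℚ.≤_) (ℚ.fromℚᵘ-toℚᵘ q)
        (/-mono 1 (suc a) (suc d) (suc d) (*-monoˡ-≤ (suc d) (s≤s (z≤n {a}))))

-- `P` need not be decidable, so the maximum is only obtained up to double negation.
¬¬-maximum : (P : ℕ → Set) → ∀ B → (∀ {n} → P n → n ≤ B) → ∃ P → ¬ ¬ (∃[ n ] P n × (∀ {m} → P m → m ≤ n))
¬¬-maximum P B ≤B (n₀ , p₀) ¬max = above (suc B) (m≤n+m (suc B) n₀) p₀
  where
  -- Downward induction: if no element exceeds n, then n itself would be the maximum.
  above : ∀ d {n} → B < n + d → ¬ P n
  above zero    {n} B<n+0 p = contradiction (≤B p) (<⇒≱ (subst (B <_) (+-identityʳ n) B<n+0))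
  above (suc d) {n} B<n+d p = ¬max (n , p , λ {m} q → ≮⇒≥ λ n<m →
    above d (≤-trans (subst (B <_) (+-suc n d) B<n+d) (+-monoˡ-≤ d n<m)) q)

-- Large directed cuts by conditional expectations

-- Twice the probability that a vertex lies on the side `true`, respectively
-- `false`, when undecided vertices are placed by a fair coin.
weightTrue weightFalse : Maybe Bool → ℕ
weightTrue nothing      = 1
weightTrue (just true)  = 2
weightTrue (just false) = 0
weightFalse nothing      = 1
weightFalse (just true)  = 0
weightFalse (just false) = 2

weight : (Fin n → Maybe Bool) → Fin n × Fin n → ℕ
weight p (u , v) = weightTrue (p u) * weightFalse (p v)

totalWeight : (Fin n → Maybe Bool) → List (Fin n × Fin n) → ℕ
totalWeight p []      = 0
totalWeight p (x ∷ L) = weight p x + totalWeight p L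

assign : (Fin n → Maybe Bool) → Fin n → Bool → Fin n → Maybe Bool
assign p a c x = if ⌊ x Fin.≟ a ⌋ then just c else p x

-- As `u ≢ v`, at most one factor of the weight depends on the side of `a`, and that factor averages
-- to its undecided value 1. For a loop at `a` both factors would change together.
weight-average : (p : Fin n → Maybe Bool) {a : Fin n} → p a ≡ nothing → ∀ {u v} → u ≢ v →
  weight (assign p a true) (u , v) + weight (assign p a false) (u , v) ≡ 2 * weight p (u , v)
weight-average p {a} pa≡ {u} {v} u≢v with u Fin.≟ a | v Fin.≟ a
... | yes refl | yes refl = contradiction refl u≢v
... | yes refl | no _     rewrite pa≡ = identity (weightFalse (p v))
  where
  identity : ∀ x → 2 * x + 0 * x ≡ 2 * (1 * x)
  identity = solve-∀
... | no _     | yes refl rewrite pa≡ = identity (weightTrue (p u))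
  where
  identity : ∀ x → x * 0 + x * 2 ≡ 2 * (x * 1)
  identity = solve-∀
... | no _     | no _     = identity (weightTrue (p u) * weightFalse (p v))
  where
  identity : ∀ x → x + x ≡ 2 * x
  identity = solve-∀

Loopless : List (Fin n × Fin n) → Set
Loopless = All (λ (u , v) → u ≢ v)

totalWeight-average : (p : Fin n → Maybe Bool) {a : Fin n} → p a ≡ nothing → ∀ {L} → Loopless L →
  totalWeight (assign p a true) L + totalWeight (assign p a false) L ≡ 2 * totalWeight p L
totalWeight-average p pa≡ []          = refl
totalWeight-average p {a} pa≡ {x ∷ L} (x≢ ∷ L≢) = begin
  (weight pₜ x + totalWeight pₜ L) + (weight pᶠ x + totalWeight pᶠ L)  ≡⟨ interchange (weight pₜ x) _ _ _ ⟩
  (weight pₜ x + weight pᶠ x) + (totalWeight pₜ L + totalWeight pᶠ L)  ≡⟨ cong₂ _+_ (weight-average p pa≡ x≢)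
                                                                                      (totalWeight-average p pa≡ L≢) ⟩
  2 * weight p x + 2 * totalWeight p L                                 ≡⟨ *-distribˡ-+ 2 (weight p x) _ ⟨
  2 * (weight p x + totalWeight p L)                                   ∎
  where
  open ≡-Reasoning
  pₜ = assign p a true
  pᶠ = assign p a false
  interchange : ∀ w x y z → (w + x) + (y + z) ≡ (w + y) + (x + z)
  interchange = solve-∀

average≤one : ∀ {x y z} → x + y ≡ 2 * z → z ≤ x ⊎ z ≤ y
average≤one {x} {y} {z} eq with ≤-total z x
... | inj₁ z≤x = inj₁ z≤x
... | inj₂ x≤z = inj₂ (+-cancelˡ-≤ z z y (begin
  z + z   ≡⟨ cong (λ w → z + w) (+-identityʳ z) ⟨
  2 * z   ≡⟨ eq ⟨
  x + y   ≤⟨ +-monoˡ-≤ y x≤z ⟩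
  z + y   ∎))
  where open ≤-Reasoning

Decided : Maybe Bool → Set
Decided s = ∃[ c ] s ≡ just c

assign-decided : (p : Fin n → Maybe Bool) (a : Fin n) (c : Bool) → Decided (assign p a c a)
assign-decided p a c with a Fin.≟ a
... | yes _  = c , refl
... | no a≢a = contradiction refl a≢a

assign-preserves : (p : Fin n → Maybe Bool) (a : Fin n) (c : Bool) → ∀ x → Decided (p x) → Decided (assign p a c x)
assign-preserves p a c x px with x Fin.≟ a
... | yes _ = c , refl
... | no _  = px

-- The method of conditional expectations: of the two ways to decide a vertex, one
-- does not decrease the total weight.
decide : ∀ {L : List (Fin n × Fin n)} → Loopless L → (vs : List (Fin n)) (p : Fin n → Maybe Bool) →
  Σ[ q ∈ (Fin n → Maybe Bool) ] totalWeight p L ≤ totalWeight q L ×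
    (∀ x → x ∈ vs ⊎ Decided (p x) → Decided (q x))
decide L≢ []       p = p , ≤-refl , λ { x (inj₂ d) → d }
decide {n} {L} L≢ (a ∷ vs) p =
  let p₁ , p≤p₁ , p₁a , keeps = step
      q , p₁≤q , decided = decide L≢ vs p₁
  in q , ≤-trans p≤p₁ p₁≤q , λ
    { x (inj₁ (here refl)) → decided x (inj₂ p₁a)
    ; x (inj₁ (there x∈))  → decided x (inj₁ x∈)
    ; x (inj₂ d)           → decided x (inj₂ (keeps x d)) }
  where
  step : Σ[ p₁ ∈ (Fin n → Maybe Bool) ] totalWeight p L ≤ totalWeight p₁ L ×
           Decided (p₁ a) × (∀ x → Decided (p x) → Decided (p₁ x))
  step with p a in eq
  ... | just c  = p , ≤-refl , (c , eq) , λ _ d → d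
  ... | nothing with average≤one (totalWeight-average p eq L≢)
  ...   | inj₁ ≤ₜ = assign p a true  , ≤ₜ , assign-decided p a true  , assign-preserves p a true
  ...   | inj₂ ≤ᶠ = assign p a false , ≤ᶠ , assign-decided p a false , assign-preserves p a false

cut : (Fin n → Bool) → Fin n × Fin n → Bool
cut c (u , v) = c u ∧ not (c v)

-- Both factors are doubled probabilities, so a pair in the cut weighs 2 * 2 and any other pair 0.
weight-decided : (q : Fin n → Maybe Bool) (c : Fin n → Bool) → (∀ x → q x ≡ just (c x)) →
                 ∀ L → totalWeight q L ≡ 4 * length (filter (T? ∘ cut c) L)
weight-decided q c q≡c [] = refl
weight-decided q c q≡c ((u , v) ∷ L) with ih ← weight-decided q c q≡c L rewrite q≡c u | q≡c v with c u | c v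
... | false | _     = ih
... | true  | true  = ih
... | true  | false = trans (cong (λ s → 4 + s) ih) (sym (*-suc 4 _))

totalWeight-undecided : (L : List (Fin n × Fin n)) → totalWeight (λ _ → nothing) L ≡ length L
totalWeight-undecided []      = refl
totalWeight-undecided (_ ∷ L) = cong suc (totalWeight-undecided L)

-- With every vertex undecided each pair weighs 1, which stands for probability 1/4; deciding all
-- vertices loses no total weight.
large-cut : {L : List (Fin n × Fin n)} → Loopless L →
            Σ[ c ∈ (Fin n → Bool) ] length L ≤ 4 * length (filter (T? ∘ cut c) L)
large-cut {n} {L} L≢ with q , ≤q , decided ← decide L≢ (allFin n) (λ _ → nothing) =
  (λ x → proj₁ (d x)) , subst₂ _≤_ (totalWeight-undecided L) (weight-decided q _ (λ x → proj₂ (d x)) L) ≤q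
  where
  d : ∀ x → Decided (q x)
  d x = decided x (inj₁ (∈-allFin x))

-- The subgraph of upward edges of a cut

module CutSubgraph (G : OrderedGraph) (c : Fin (order G) → Bool) where
  private module G = OrderedGraph G

  upCut : Fin (order G) → Fin (order G) → Bool
  upCut u v = ⌊ u Fin.<? v ⌋ ∧ cut c (u , v)

  adj : Fin (order G) → Fin (order G) → Bool
  adj u v = G.adj u v ∧ (upCut u v ∨ upCut v u)

  subgraph : Subgraph G
  subgraph = record
    { vertices  = Subset.⊤
    ; adj       = adj
    ; symmetric = λ {u} {v} uv → let e , s = to (T-∧ {G.adj u v}) uv in
        from (T-∧ {G.adj v u}) (G.symmetric e , from (T-∨ {upCut v u}) (Sum.swap (to (T-∨ {upCut u v}) s)))
    ; edges⊆    = λ {u} {v} uv → proj₁ (to (T-∧ {G.adj u v}) uv)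
    ; endpoints = λ _ → ∈⊤ , ∈⊤
    }

  edge-cut : ∀ {u v} → u Fin.< v → T (adj u v) → T (c u) × T (not (c v))
  edge-cut {u} {v} u<v uv with to (T-∨ {upCut u v}) (proj₂ (to (T-∧ {G.adj u v}) uv))
  ... | inj₁ s = to (T-∧ {c u}) (proj₂ (to (T-∧ {⌊ u Fin.<? v ⌋}) s))
  ... | inj₂ s = contradiction (toWitness (proj₁ (to (T-∧ {⌊ v Fin.<? u ⌋}) s))) (<-asym u<v)

  cut-edges≤ : length (filter (T? ∘ cut c) (edges G.adj)) ≤ eₛ subgraph
  cut-edges≤ = length-mono-⊆ (Unique.filter⁺ _ (edges-unique G.adj)) ⊆edges
    where
    ⊆edges : ∀ {p} → p ∈ filter (T? ∘ cut c) (edges G.adj) → p ∈ edges adj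
    ⊆edges {u , v} p∈ =
      let p∈′ , cuv = ∈-filter⁻ (T? ∘ cut c) {xs = edges G.adj} p∈
          u<v , uv  = ∈-edges⁻ G.adj p∈′
      in ∈-edges⁺ adj u<v (from (T-∧ {G.adj u v}) (uv ,
           from (T-∨ {upCut u v}) (inj₁ (from (T-∧ {⌊ u Fin.<? v ⌋}) (fromWitness u<v , cuv)))))

  -- The middle vertex of the path would be the lower end of one kept edge and the upper end of
  -- another, hence on both sides of the cut.
  free : ∀ {F} → HasMonotonePath₂ F → subgraph IsFree F
  free {F} (u , v , w , u<v , v<w , uv , vw) C =
    T-not (c (map v)) (proj₁ (edge-cut (map-< v<w) (edgePreserving vw)))
                      (proj₂ (edge-cut (map-< u<v) (edgePreserving uv)))
    where
    open _Contains_ C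
    map-< : ∀ {x y} → x Fin.< y → map x Fin.< map y
    map-< x<y = Fin.≤∧≢⇒< (orderPreserving (<⇒≤ x<y)) (Fin.<⇒≢ x<y ∘ injective)
    T-not : ∀ b → T b → ¬ T (not b)
    T-not true _ ()

monotonePath-free-subgraph : (F G : OrderedGraph) → HasMonotonePath₂ F →
                             Σ[ G′ ∈ Subgraph G ] G′ IsFree F × e G ≤ 4 * eₛ G′
monotonePath-free-subgraph F G path
  with c , ≤cut ← large-cut {L = edges (OrderedGraph.adj G)} (All.tabulate λ p∈ → Fin.<⇒≢ (proj₁ (∈-edges⁻ _ p∈))) =
  subgraph , free path , ≤-trans ≤cut (*-monoʳ-≤ 4 cut-edges≤)
  where open CutSubgraph G c

-- Bounds on the densities, and the theorem

eₛ≤e : ∀ {G} (G′ : Subgraph G) → eₛ G′ ≤ e G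
eₛ≤e {G} G′ = length-mono-⊆ (edges-unique adj) λ p∈ →
  let u<v , uv = ∈-edges⁻ adj p∈ in ∈-edges⁺ (OrderedGraph.adj G) u<v (edges⊆ uv)
  where open Subgraph G′

-- The double negation avoids deciding F-freeness. It is harmless because the
-- inequality to be proved between rationals is stable.
¬¬-relativeDensity : (F G : OrderedGraph) .{{_ : NonZero (e G)}} → ¬ ¬ ∃ (IsRelativeDensity F G)
¬¬-relativeDensity F G none = ¬¬-excluded-middle {A = ∃ (FreeRatio F G)} λ
  { (no ∄ratio) → none (0ℚ , inj₂ (∄ratio , refl))
  ; (yes (_ , G′ , free , _)) → ¬¬-maximum Size (e G) (λ { (H , _ , refl) → eₛ≤e H }) (eₛ G′ , G′ , free , refl)
      λ { (n , (H , H-free , n≡) , max) → none ((ℤ.+ n) / e G , inj₁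
        ((H , H-free , cong (λ k → (ℤ.+ k) / e G) n≡) , λ { _ (H′ , H′-free , refl) → /-mono (eₛ H′) n (e G) (e G) (*-monoˡ-≤ (e G) (max (H′ , H′-free , refl))) })) } }
  where
  Size : ℕ → Set
  Size n = Σ[ H ∈ Subgraph G ] H IsFree F × n ≡ eₛ H

quarter≤/ : ∀ s N .{{_ : NonZero N}} → N ≤ 4 * s → (ℤ.+ 1) / 4 ℚ.≤ (ℤ.+ s) / N
quarter≤/ s N N≤4s = /-mono 1 s 4 N (subst₂ _≤_ (sym (*-identityˡ N)) (*-comm 4 s) N≤4s)

quarter≤density : (F G : OrderedGraph) .{{_ : NonZero (e G)}} → HasMonotonePath₂ F →
                  ∀ q → IsRelativeDensity F G q → (ℤ.+ 1) / 4 ℚ.≤ q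
quarter≤density F G path q = quarter≤ (monotonePath-free-subgraph F G path)
  where
  quarter≤ : Σ[ G′ ∈ Subgraph G ] G′ IsFree F × e G ≤ 4 * eₛ G′ →
             IsRelativeDensity F G q → (ℤ.+ 1) / 4 ℚ.≤ q
  quarter≤ (G′ , free , e≤4eₛ) (inj₁ (_ , max))    =
    ℚ.≤-trans (quarter≤/ (eₛ G′) (e G) e≤4eₛ) (max _ (G′ , free , refl))
  -- The convention for the empty set does not apply, since the cut subgraph is `F`-free.
  quarter≤ (G′ , free , _)     (inj₂ (∄ratio , _)) = contradiction (_ , G′ , free , refl) ∄ratio

0≤density : (F G : OrderedGraph) .{{_ : NonZero (e G)}} → ∀ q → IsRelativeDensity F G q → 0ℚ ℚ.≤ q
0≤density F G q (inj₁ ((G′ , _ , refl) , _)) = /-mono 0 (eₛ G′) 1 (e G) z≤n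
0≤density F G q (inj₂ (_ , refl))            = ℚ.≤-refl

-- The factor `suc (suc t)` exceeds the denominator `suc t` by one to make the inequality strict: a
-- ratio of at least `1 / suc t` would force `eₛ G′`, and with it `e G`, to be zero.
sparse-density : (F G : OrderedGraph) .{{_ : NonZero (e G)}} → ∀ t →
                 (∀ (G′ : Subgraph G) → G′ IsFree F → suc (suc t) * eₛ G′ ≤ e G) →
                 ∀ q → IsRelativeDensity F G q → ¬ ((ℤ.+ 1) / suc t ℚ.≤ q)
sparse-density F G t sparse q (inj₂ (_ , refl)) 1/t≤0 =
  contradiction (/-reflects 1 0 (suc t) 1 1/t≤0) λ ()
sparse-density F G t sparse q (inj₁ ((G′ , free , refl) , _)) 1/t≤q =
  ≢-nonZero⁻¹ (e G) (too-many (eₛ G′) (e G) (/-reflects 1 (eₛ G′) (suc t) (e G) 1/t≤q) (sparse G′ free))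
  where
  too-many : ∀ s N → 1 * N ≤ s * suc t → suc (suc t) * s ≤ N → N ≡ 0
  too-many zero    N N≤ _  = n≤0⇒n≡0 (subst (_≤ 0) (*-identityˡ N) N≤)
  too-many (suc s) N N≤ ≤N = contradiction
    (≤-trans ≤N (subst₂ _≤_ (*-identityˡ N) (*-comm (suc s) (suc t)) N≤))
    (<⇒≱ (*-monoˡ-< (suc s) (n<1+n (suc t))))

-- A positive lower bound is at least some `1 / suc t`, but a suitable graph has smaller density.
-- That this density exists only up to double negation suffices for a contradiction.
lowerBound≤0 : (F : OrderedGraph) → ¬ HasMonotonePath₂ F → ∀ β →
               (∀ q → ∃[ G ] ∃[ nz ] IsRelativeDensity F G {{nz}} q → β ℚ.≤ q) → β ℚ.≤ 0ℚ
lowerBound≤0 F noPath β β≤ = decidable-stable (β ℚ.≤? 0ℚ) λ β≰0 →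
  let t , 1/t≤β = unit-fraction-below β β≰0
  in refute t 1/t≤β (sparse-free-subgraphs F noPath (suc (suc t)))
  where
  refute : ∀ t → (ℤ.+ 1) / suc t ℚ.≤ β →
           ¬ (∃[ G ] NonZero (e G) × (∀ (G′ : Subgraph G) → G′ IsFree F → suc (suc t) * eₛ G′ ≤ e G))
  refute t 1/t≤β (G , nz , sparse) = ¬¬-relativeDensity F G {{nz}} λ (q , density) →
    sparse-density F G {{nz}} t sparse q density (ℚ.≤-trans 1/t≤β (β≤ q (G , nz , density)))

theorem1p3 : (F : OrderedGraph) → IsRelativeTuránDensity F 0ℚ ⇔ (¬ HasMonotonePath₂ F)
theorem1p3 F = mk⇔
  (λ (_ , greatest) path → contradiction
    (greatest ((ℤ.+ 1) / 4) λ q (G , nz , density) → quarter≤density F G {{nz}} path q density)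
    λ { (ℚ.*≤* (ℤ.+≤+ ())) })
  (λ noPath → (λ q (G , nz , density) → 0≤density F G {{nz}} q density) , lowerBound≤0 F noPath)
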